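{- For every positive integer $n\geq 8$, there exists an equinumerous $4$-coloring of $[n]=\{1,2,\dots,n\}$ with no rainbow $AP(4)$.
   Context: A $k$-coloring of $[n]=\{1,\dots,n\}$ is a map $[n]\to\{1,\dots,k\}$. It is called equinumerous (balanced) if every color class has at least $\lfloor n/k\rfloor$ elements. A rainbow $AP(k)$ in a $k$-coloring of $[n]$ is an arithmetic progression $t, t+d, \dots, t+(k-1)d$ with $d\geq 1$ and all terms in $[n]$, whose $k$ terms receive $k$ pairwise distinct colors. -}

module Defs where

open import Data.Nat using (ℕ; zero; suc; _+_; _*_; _≤_; _/_; NonZero)
open import Data.Fin using (Fin)
open import Data.Fin.Properties using (_≟_)
open import Data.List using (List; length; filter; upTo; map)
open import Relation.Binary.PropositionalEquality using (_≡_; _≢_)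
open import Data.Product using (∃-syntax; _×_)

-- A k-coloring of [n] = {1,…,n}: we represent it as a map ℕ → Fin k;
-- only the values on 1,…,n are ever used.
Coloring : ℕ → Set
Coloring k = ℕ → Fin k

range : ℕ → List ℕ
range n = map suc (upTo n)

classSize : ∀ {k} → ℕ → Coloring k → Fin k → ℕ
classSize n c j = length (filter (λ x → c x ≟ j) (range n))

Equinumerous : (n k : ℕ) .{{_ : NonZero k}} → Coloring k → Set
Equinumerous n k c = ∀ (j : Fin k) → n / k ≤ classSize n c j

term : ℕ → ℕ → ℕ → ℕ
term t d i = t + i * d

RainbowAP : (n k : ℕ) → Coloring k → Set
RainbowAP n k c =
  ∃[ t ] ∃[ d ] (1 ≤ t × 1 ≤ d × (∀ (i : Fin k) → term t d (Data.Fin.toℕ i) ≤ n)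
    × (∀ (i j : Fin k) → i ≢ j → c (term t d (Data.Fin.toℕ i)) ≢ c (term t d (Data.Fin.toℕ j))))

{-# OPTIONS --safe #-}
-- Periodic colouring of period 4 with two palettes: on the residues 0,1,2,3 the
-- left palette uses the colours 0,0,1,2 and the right palette 1,2,3,3.
-- If d is even, a progression of difference d meets at most three colours. If d is
-- odd it meets every residue once, and its colours are distinct only when the
-- palettes alternate along it. A left part of the form [1,s] ∖ {e} with e ≤ 2 and
-- 4 ≤ s never alternates along a four-term progression. With ⌊n/4⌋ = q, taking
-- s = 4m and e = 0 for q = 2m, and s = 4m + 3 and e = 2 for q = 2m + 1, makes every
-- colour occur exactly q times on [4q].
module Submission where

open import Defs
open import Data.Bool using (Bool; true; false)
import Data.Bool.Properties as Bool
open import Data.Empty using (⊥)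
open import Data.Fin using (Fin; zero; suc; toℕ; #_)
open import Data.Fin.Properties using (_≟_; all?; any?)
open import Data.Fin.Subset.Properties using (anySubset?)
open import Data.List using (List; []; _∷_; length; filter; map; applyUpTo; _++_)
open import Data.List.Properties using (map-upTo; filter-++; length-++)
open import Data.Nat using (ℕ; zero; suc; _+_; _*_; _∸_; _≤_; _<_; _/_; z≤n; s≤s)
open import Data.Nat.DivMod using (_divMod_; result; m/n*n≤m; /-monoˡ-≤)
open import Data.Nat.Properties as ℕ using (≤-trans; ≤-refl; ≤-reflexive; <⇒≱)
open import Data.Nat.Tactic.RingSolver using (solve-∀)
open import Data.Product using (∃-syntax; _×_; _,_; proj₁)
open import Data.Vec using (Vec; lookup; tabulate)
open import Data.Vec.Properties using (lookup∘tabulate)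
open import Function using (_∘_; _$_; _∋_)
open import Relation.Binary.PropositionalEquality
open import Relation.Nullary using (¬_; Dec; yes; no; does; proof)
open import Relation.Nullary.Reflects using (Reflects; invert)
open import Relation.Nullary.Decidable using (¬?; _×-dec_; _→-dec_; dec-true; dec-false; from-no; decidable-stable)

-- Counting color classes over intervals.

classSize-suc : ∀ {k} n (c : Coloring k) j →
  classSize (suc n) c j ≡ classSize 1 c j + classSize n (c ∘ suc) j
classSize-suc n c j = begin
  size c (1 ∷ map suc (applyUpTo suc n))
    ≡⟨ cong (λ xs → size c (1 ∷ map suc xs)) (map-upTo suc n) ⟨
  size c (1 ∷ map suc (range n))
    ≡⟨ cong length (filter-++ (λ x → c x ≟ j) (1 ∷ []) _) ⟩
  length (filter (λ x → c x ≟ j) (1 ∷ []) ++ filter (λ x → c x ≟ j) (map suc (range n)))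
    ≡⟨ length-++ (filter (λ x → c x ≟ j) (1 ∷ [])) ⟩
  classSize 1 c j + size c (map suc (range n))
    ≡⟨ cong (classSize 1 c j +_) (size-map-suc (range n)) ⟩
  classSize 1 c j + classSize n (c ∘ suc) j ∎
  where
  open ≡-Reasoning
  size : Coloring _ → List ℕ → ℕ
  size c xs = length (filter (λ x → c x ≟ j) xs)
  size-map-suc : ∀ xs → size c (map suc xs) ≡ size (c ∘ suc) xs
  size-map-suc []       = refl
  size-map-suc (x ∷ xs) with does (c (suc x) ≟ j)
  ... | true  = cong suc (size-map-suc xs)
  ... | false = size-map-suc xs

classSize-+ : ∀ {k} m n (c : Coloring k) j →
  classSize (m + n) c j ≡ classSize m c j + classSize n (c ∘ (m +_)) j
classSize-+ zero    n c j = refl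
classSize-+ (suc m) n c j = begin
  classSize (suc m + n) c j
    ≡⟨ classSize-suc (m + n) c j ⟩
  classSize 1 c j + classSize (m + n) (c ∘ suc) j
    ≡⟨ cong (classSize 1 c j +_) (classSize-+ m n (c ∘ suc) j) ⟩
  classSize 1 c j + (classSize m (c ∘ suc) j + classSize n (c ∘ (suc m +_)) j)
    ≡⟨ ℕ.+-assoc (classSize 1 c j) _ _ ⟨
  classSize 1 c j + classSize m (c ∘ suc) j + classSize n (c ∘ (suc m +_)) j
    ≡⟨ cong (_+ classSize n (c ∘ (suc m +_)) j) (classSize-suc m c j) ⟨
  classSize (suc m) c j + classSize n (c ∘ (suc m +_)) j ∎
  where open ≡-Reasoning

classSize-cong : ∀ {k} n {c c′ : Coloring k} j →
  (∀ {x} → 1 ≤ x → x ≤ n → c x ≡ c′ x) → classSize n c j ≡ classSize n c′ j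
classSize-cong zero    j c≗c′ = refl
classSize-cong (suc n) {c} {c′} j c≗c′ = begin
  classSize (suc n) c j
    ≡⟨ classSize-suc n c j ⟩
  classSize 1 c j + classSize n (c ∘ suc) j
    ≡⟨ cong₂ _+_ first
         (classSize-cong n j λ _ x≤n → c≗c′ (s≤s z≤n) (s≤s x≤n)) ⟩
  classSize 1 c′ j + classSize n (c′ ∘ suc) j
    ≡⟨ classSize-suc n c′ j ⟨
  classSize (suc n) c′ j ∎
  where
  open ≡-Reasoning
  first : classSize 1 c j ≡ classSize 1 c′ j
  -- Abstracting the equality of the two tests along with them leaves only the cases where they
  -- agree.
  first with does (c 1 ≟ j) | does (c′ 1 ≟ j) | cong (λ i → does (i ≟ j)) (c≗c′ (s≤s z≤n) (s≤s z≤n))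
  ... | true  | true  | _ = refl
  ... | false | false | _ = refl

classSize-mono : ∀ {k m n} (c : Coloring k) j → m ≤ n → classSize m c j ≤ classSize n c j
classSize-mono {m = m} {n} c j m≤n = begin
  classSize m c j                                        ≤⟨ ℕ.m≤m+n _ _ ⟩
  classSize m c j + classSize (n ∸ m) (c ∘ (m +_)) j     ≡⟨ classSize-+ m (n ∸ m) c j ⟨
  classSize (m + (n ∸ m)) c j                            ≡⟨ cong (λ i → classSize i c j) (ℕ.m+[n∸m]≡n m≤n) ⟩
  classSize n c j                                        ∎
  where open ℕ.≤-Reasoning

classSize-periodic : ∀ {k} m r (c : Coloring k) j → (∀ x → c (4 + x) ≡ c x) →
  classSize (m * 4 + r) c j ≡ m * classSize 4 c j + classSize r c j
classSize-periodic zero    r c j periodic = refl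
classSize-periodic (suc m) r c j periodic = begin
  classSize (4 + (m * 4 + r)) c j
    ≡⟨ classSize-+ 4 (m * 4 + r) c j ⟩
  classSize 4 c j + classSize (m * 4 + r) (c ∘ (4 +_)) j
    ≡⟨ cong (classSize 4 c j +_) (classSize-cong (m * 4 + r) j λ {x} _ _ → periodic x) ⟩
  classSize 4 c j + classSize (m * 4 + r) c j
    ≡⟨ cong (classSize 4 c j +_) (classSize-periodic m r c j periodic) ⟩
  classSize 4 c j + (m * classSize 4 c j + classSize r c j)
    ≡⟨ ℕ.+-assoc (classSize 4 c j) _ _ ⟨
  suc m * classSize 4 c j + classSize r c j ∎
  where open ≡-Reasoning

-- The two palettes and rainbow progressions modulo 4.

-- The side true is the left one.
palette : Bool → Coloring 4
palette b (suc (suc (suc (suc x)))) = palette b x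
palette true  0 = # 0
palette true  1 = # 0
palette true  2 = # 1
palette true  3 = # 2
palette false 0 = # 1
palette false 1 = # 2
palette false 2 = # 3
palette false 3 = # 3

paint : (ℕ → Bool) → Coloring 4
paint left x = palette (left x) x

palette-periodic : ∀ b m x → palette b (m * 4 + x) ≡ palette b x
palette-periodic b zero    x = refl
palette-periodic b (suc m) x = palette-periodic b m x

Rainbow : (Fin 4 → Fin 4) → Set
Rainbow f = ∀ i j → i ≢ j → f i ≢ f j

rainbow? : ∀ f → Dec (Rainbow f)
rainbow? f = all? λ i → all? λ j → ¬? (i ≟ j) →-dec ¬? (f i ≟ f j)

Alternating : Vec Bool 4 → Set
Alternating s = lookup s (# 0) ≡ lookup s (# 2) × lookup s (# 1) ≡ lookup s (# 3)
              × lookup s (# 0) ≢ lookup s (# 1)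

alternating? : ∀ s → Dec (Alternating s)
alternating? s = (_ Bool.≟ _) ×-dec (_ Bool.≟ _) ×-dec ¬? (_ Bool.≟ _)

-- The sides form a separate vector because, unlike the palettes, they are not periodic: `t` and `d`
-- can be reduced modulo 4 while the sides stay those of the original terms.
progressionColors : ℕ → ℕ → Vec Bool 4 → Fin 4 → Fin 4
progressionColors t d s i = palette (lookup s i) (term t d (toℕ i))

-- For odd difference, the pairs {0,1}, {0,2}, {1,3}, {2,3} of colors available at the residues 0,
-- 1, 2, 3 are the edges of a 4-cycle on the colors. Distinct choices orient this cycle
-- consistently, and in both orientations the side is determined by the parity of the residue.
rainbow⇒alternating-mod4 : (r q : Fin 4) (s : Vec Bool 4) →
  Rainbow (progressionColors (toℕ r) (toℕ q) s) → Alternating s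
rainbow⇒alternating-mod4 r q s rainbow = decidable-stable (alternating? s)
  λ ¬alternating → exhausted (r , q , s , rainbow , ¬alternating)
  where
  -- A search through 4 · 4 · 16 cases; `anySubset?` applies since a subset of `Fin 4` is a vector
  -- of four Booleans.
  exhausted = from-no (any? λ (r : Fin 4) → any? λ (q : Fin 4) → anySubset? λ s →
    rainbow? (progressionColors (toℕ r) (toℕ q) s) ×-dec ¬? (alternating? s))

rainbow⇒alternating : ∀ left t d → Rainbow (λ i → paint left (term t d (toℕ i))) →
  Alternating (tabulate λ i → left (term t d (toℕ i)))
rainbow⇒alternating left t d rainbow with t divMod 4 | d divMod 4
... | result m r t≡ | result l q d≡ = rainbow⇒alternating-mod4 r q sides
  λ i j i≢j eq → rainbow i j i≢j (trans (reduce i) (trans eq (sym (reduce j))))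
  where
  sides = tabulate λ i → left (term t d (toℕ i))
  regroup : ∀ r m i q l → (r + m * 4) + i * (q + l * 4) ≡ (m + i * l) * 4 + (r + i * q)
  regroup = solve-∀
  reduce : ∀ i → paint left (term t d (toℕ i)) ≡ progressionColors (toℕ r) (toℕ q) sides i
  reduce i = begin
    palette (left (term t d (toℕ i))) (term t d (toℕ i))
      ≡⟨ cong₂ palette (sym (lookup∘tabulate (λ i → left (term t d (toℕ i))) i)) (cong₂ (λ t d → term t d (toℕ i)) t≡ d≡) ⟩
    palette (lookup sides i) (term (toℕ r + m * 4) (toℕ q + l * 4) (toℕ i))
      ≡⟨ cong (palette (lookup sides i)) (regroup (toℕ r) m (toℕ i) (toℕ q) l) ⟩
    palette (lookup sides i) ((m + toℕ i * l) * 4 + term (toℕ r) (toℕ q) (toℕ i))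
      ≡⟨ palette-periodic (lookup sides i) (m + toℕ i * l) _ ⟩
    progressionColors (toℕ r) (toℕ q) sides i ∎
    where open ≡-Reasoning

-- The coloring and its lack of rainbow progressions.

-- Since 0 lies outside [n], `e = 0` removes nothing, so one definition serves both parities of q.
left? : ∀ e s x → Dec (x ≤ s × x ≢ e)
left? e s x = x ℕ.≤? s ×-dec ¬? (x ℕ.≟ e)

coloring : ℕ → ℕ → Coloring 4
coloring e s = paint λ x → does (left? e s x)

-- Under alternation, a right term lying before a left one is at most `s`, hence equals `e`. If the
-- first and third terms are left, this makes the second term at most 2, and then the fourth is left
-- as well. If the second and fourth are left, it makes the third term at most 2, but that term is
-- at least 3.
coloring-rainbow-free : ∀ {e s} → e ≤ 2 → 4 ≤ s → ∀ n → ¬ RainbowAP n 4 (coloring e s)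
coloring-rainbow-free {e} {s} e≤2 4≤s n (t , d , 1≤t , 1≤d , _ , rainbow)
  with rainbow⇒alternating (λ x → does (left? e s x)) t d rainbow
... | first≡third , second≡fourth , first≢second = absurd (left? e s (x 0)) (left? e s (x 1))
  where
  x : ℕ → ℕ
  x = term t d

  Left : ℕ → Set
  Left i = x i ≤ s × x i ≢ e

  transport : ∀ i j → does (left? e s (x i)) ≡ does (left? e s (x j)) → Left i → Left j
  transport i j eq Li =
    invert (subst (Reflects _) (trans (sym eq) (dec-true (left? e s (x i)) Li)) (proof (left? e s (x j))))

  x-mono : ∀ i j → i ≤ j → x i ≤ x j
  x-mono i j i≤j = ℕ.+-monoʳ-≤ t (ℕ.*-monoˡ-≤ d i≤j)

  index<x : ∀ i → i < x i
  index<x i = ℕ.+-mono-≤ 1≤t (≤-trans (≤-reflexive (sym (ℕ.*-identityʳ i))) (ℕ.*-monoʳ-≤ i 1≤d))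

  exceptional : ∀ i → x i ≤ s → ¬ Left i → x i ≤ 2
  exceptional i xi≤s ¬Li = ≤-trans (≤-reflexive xi≡e) e≤2
    where xi≡e = decidable-stable (x i ℕ.≟ e) λ xi≢e → ¬Li (xi≤s , xi≢e)

  -- From `1 ≤ t` and `t + d ≤ 2` follows `d ≤ 1`, so the fourth term is at most 4; it exceeds 3, so
  -- it is not `e`.
  Left-fourth : x 1 ≤ 2 → Left 3
  Left-fourth x1≤2 = ≤-trans x3≤4 4≤s , λ x3≡e → <⇒≱ (index<x 3) (≤-trans (≤-reflexive x3≡e) (ℕ.m≤n⇒m≤1+n e≤2))
    where
    split : ∀ t d → t + 3 * d ≡ (t + 1 * d) + 2 * d
    split = solve-∀
    d≤1 : d ≤ 1
    d≤1 = ℕ.≤-pred (≤-trans (ℕ.+-mono-≤ 1≤t (≤-reflexive (sym (ℕ.*-identityˡ d)))) x1≤2)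
    x3≤4 : x 3 ≤ 4
    x3≤4 = ≤-trans (≤-reflexive (split t d)) (ℕ.+-mono-≤ x1≤2 (ℕ.*-monoʳ-≤ 2 d≤1))

  absurd : Dec (Left 0) → Dec (Left 1) → ⊥
  absurd (yes L0) (yes L1) = first≢second (trans (dec-true (left? e s (x 0)) L0) (sym (dec-true (left? e s (x 1)) L1)))
  absurd (no ¬L0) (no ¬L1) = first≢second (trans (dec-false (left? e s (x 0)) ¬L0) (sym (dec-false (left? e s (x 1)) ¬L1)))
  absurd (yes L0) (no ¬L1) = ¬L1 (transport 3 1 (sym second≡fourth) (Left-fourth (exceptional 1 x1≤s ¬L1)))
    where x1≤s = ≤-trans (x-mono 1 2 (s≤s z≤n)) (proj₁ (transport 0 2 first≡third L0))
  absurd (no ¬L0) (yes L1) = <⇒≱ (index<x 2) (exceptional 2 x2≤s (¬L0 ∘ transport 2 0 (sym first≡third)))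
    where x2≤s = ≤-trans (x-mono 2 3 (s≤s (s≤s z≤n))) (proj₁ (transport 1 3 second≡fourth L1))

-- Exact class sizes on [4q].

coloring-left : ∀ e s x → x ≤ s → x ≢ e → coloring e s x ≡ palette true x
coloring-left e s x x≤s x≢e = cong (λ b → palette b x) (dec-true (left? e s x) (x≤s , x≢e))

coloring-right : ∀ e s x → 1 ≤ x → coloring e s (s + x) ≡ palette false (s + x)
coloring-right e s x 1≤x =
  cong (λ b → palette b (s + x)) (dec-false (left? e s (s + x)) (<⇒≱ (ℕ.m<m+n s 1≤x) ∘ proj₁))

palette-shift : ∀ b m r x → palette b ((m * 4 + r) + x) ≡ palette b (r + x)
palette-shift b m r x = trans (cong (palette b) (ℕ.+-assoc (m * 4) r x)) (palette-periodic b m (r + x))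

-- Over one period the colors 0, 1, 2, 3 occur 2, 1, 1, 0 times in the left palette and 0, 1, 1, 2
-- times in the right one, which adds up to 2 each.
equinumerous-even : ∀ m j → classSize (m * 2 * 4) (coloring 0 (m * 4 + 0)) j ≡ m * 2
equinumerous-even m j = begin
  classSize (m * 2 * 4) c j
    ≡⟨ cong (λ n → classSize n c j) (halve m) ⟩
  classSize (s + s) c j
    ≡⟨ classSize-+ s s c j ⟩
  classSize s c j + classSize s (c ∘ (s +_)) j
    ≡⟨ cong₂ _+_ (classSize-cong s j on-left) (classSize-cong s j on-right) ⟩
  classSize s (palette true) j + classSize s (palette false) j
    ≡⟨ cong₂ _+_ (classSize-periodic m 0 (palette true) j λ _ → refl)
         (classSize-periodic m 0 (palette false) j λ _ → refl) ⟩
  (m * classSize 4 (palette true) j + 0) + (m * classSize 4 (palette false) j + 0)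
    ≡⟨ total j ⟩
  m * 2 ∎
  where
  open ≡-Reasoning
  -- The summand 0 gives `s` the shape `m * 4 + r` of `classSize-periodic` and `palette-shift`.
  s = m * 4 + 0
  c = coloring 0 s
  halve : ∀ m → m * 2 * 4 ≡ (m * 4 + 0) + (m * 4 + 0)
  halve = solve-∀
  on-left : ∀ {x} → 1 ≤ x → x ≤ s → c x ≡ palette true x
  on-left {x} 1≤x x≤s = coloring-left 0 s x x≤s (ℕ.m<n⇒n≢0 1≤x)
  on-right : ∀ {x} → 1 ≤ x → x ≤ s → c (s + x) ≡ palette false x
  on-right {x} 1≤x _ = trans (coloring-right 0 s x 1≤x) (palette-shift false m 0 x)
  total : ∀ j → (m * classSize 4 (palette true) j + 0) + (m * classSize 4 (palette false) j + 0) ≡ m * 2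
  -- For a fixed color the sizes over a period evaluate to numerals, leaving an identity in `m`.
  total zero                   = (∀ m → (m * 2 + 0) + (m * 0 + 0) ≡ m * 2) ∋ solve-∀ $ m
  total (suc zero)             = (∀ m → (m * 1 + 0) + (m * 1 + 0) ≡ m * 2) ∋ solve-∀ $ m
  total (suc (suc zero))       = (∀ m → (m * 1 + 0) + (m * 1 + 0) ≡ m * 2) ∋ solve-∀ $ m
  total (suc (suc (suc zero))) = (∀ m → (m * 0 + 0) + (m * 2 + 0) ≡ m * 2) ∋ solve-∀ $ m

-- The block [1,4] contains the exception 2 and is counted separately: 2, 0, 1, 1. The incomplete
-- periods add 1, 1, 1, 0 on the left and 0, 1, 0, 0 on the right, and the extra full right period
-- 0, 1, 1, 2 brings every color to 3.
equinumerous-odd : ∀ m j →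
  classSize ((1 + (1 + m) * 2) * 4) (coloring 2 (4 + (m * 4 + 3))) j ≡ 1 + (1 + m) * 2
equinumerous-odd m j = begin
  classSize ((1 + (1 + m) * 2) * 4) c j
    ≡⟨ cong (λ n → classSize n c j) (split m) ⟩
  classSize (4 + (a + b)) c j
    ≡⟨ classSize-+ 4 (a + b) c j ⟩
  classSize 4 c j + classSize (a + b) (c ∘ (4 +_)) j
    ≡⟨ cong (classSize 4 c j +_) (classSize-+ a b (c ∘ (4 +_)) j) ⟩
  classSize 4 c j + (classSize a (c ∘ (4 +_)) j + classSize b (c ∘ (4 + a +_)) j)
    ≡⟨ cong (classSize 4 c j +_) (cong₂ _+_ (classSize-cong a j on-left) (classSize-cong b j on-right)) ⟩
  classSize 4 c j + (classSize a (palette true) j + classSize b (palette false ∘ (3 +_)) j)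
    ≡⟨ cong (classSize 4 c j +_)
         (cong₂ _+_ (classSize-periodic m 3 (palette true) j λ _ → refl)
           (classSize-periodic (1 + m) 1 (palette false ∘ (3 +_)) j λ _ → refl)) ⟩
  sum j
    ≡⟨ total j ⟩
  1 + (1 + m) * 2 ∎
  where
  open ≡-Reasoning
  a = m * 4 + 3
  b = (1 + m) * 4 + 1
  -- The leading 4 lets the sides of 1, 2, 3, 4 compute while `m` is a variable.
  c = coloring 2 (4 + a)
  split : ∀ m → (1 + (1 + m) * 2) * 4 ≡ 4 + ((m * 4 + 3) + ((1 + m) * 4 + 1))
  split = solve-∀
  on-left : ∀ {x} → 1 ≤ x → x ≤ a → c (4 + x) ≡ palette true x
  on-left {x} _ x≤a = coloring-left 2 (4 + a) (4 + x) (ℕ.+-monoʳ-≤ 4 x≤a) λ ()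
  on-right : ∀ {x} → 1 ≤ x → x ≤ b → c (4 + a + x) ≡ palette false (3 + x)
  on-right {x} 1≤x _ = trans (coloring-right 2 (4 + a) x 1≤x) (palette-shift false m 3 x)
  sum : Fin 4 → ℕ
  sum j = classSize 4 c j + ((m * classSize 4 (palette true) j + classSize 3 (palette true) j)
        + ((1 + m) * classSize 4 (palette false ∘ (3 +_)) j + classSize 1 (palette false ∘ (3 +_)) j))
  total : ∀ j → sum j ≡ 1 + (1 + m) * 2
  total zero                   = (∀ m → 2 + ((m * 2 + 1) + ((1 + m) * 0 + 0)) ≡ 1 + (1 + m) * 2) ∋ solve-∀ $ m
  total (suc zero)             = (∀ m → 0 + ((m * 1 + 1) + ((1 + m) * 1 + 1)) ≡ 1 + (1 + m) * 2) ∋ solve-∀ $ m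
  total (suc (suc zero))       = (∀ m → 1 + ((m * 1 + 1) + ((1 + m) * 1 + 0)) ≡ 1 + (1 + m) * 2) ∋ solve-∀ $ m
  total (suc (suc (suc zero))) = (∀ m → 1 + ((m * 0 + 0) + ((1 + m) * 2 + 0)) ≡ 1 + (1 + m) * 2) ∋ solve-∀ $ m

-- Choice of the parameters and conclusion.

balanced : ∀ q → 2 ≤ q →
  ∃[ e ] ∃[ s ] (e ≤ 2 × 4 ≤ s × (∀ j → classSize (q * 4) (coloring e s) j ≡ q))
balanced q 2≤q with q divMod 2
balanced _ (s≤s (s≤s _)) | result (suc m) zero       refl =
  0 , _ , z≤n , ℕ.m≤m+n 4 _ , equinumerous-even (suc m)
balanced _ (s≤s (s≤s _)) | result (suc m) (suc zero) refl =
  2 , _ , ≤-refl , ℕ.m≤m+n 4 _ , equinumerous-odd m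
-- The case q = 1, where `s` would be 3, is ruled out by `2 ≤ q`.
balanced _ (s≤s ())      | result zero    (suc zero) refl

theorem1p1 : ∀ (n : ℕ) → 8 ≤ n → ∃[ c ] (Equinumerous n 4 c × ¬ RainbowAP n 4 c)
theorem1p1 n 8≤n with balanced (n / 4) (/-monoˡ-≤ 4 8≤n)
... | e , s , e≤2 , 4≤s , sizes = coloring e s , equinumerous , coloring-rainbow-free e≤2 4≤s n
  where
  equinumerous : Equinumerous n 4 (coloring e s)
  -- The at most three elements beyond `n / 4 * 4` can only enlarge the classes.
  equinumerous j = ≤-trans (≤-reflexive (sym (sizes j))) (classSize-mono (coloring e s) j (m/n*n≤m n 4))
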